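{- For every integer $n\ge 5$ with $n\equiv 2 \pmod 3$, there exists a $2$-connected subcubic $n$-vertex graph $G$ such that $$\mathrm{minexc}(G)=\frac{n(G)+n_2(G)}{4}+1 .$$
   Context: All graphs are finite and simple. A graph is subcubic if every vertex has degree at most three. A graph is $2$-connected if it has at least three vertices and is connected and remains connected after the removal of any single vertex. $n(G)$ is the number of vertices of $G$ and $n_2(G)$ is the number of vertices of degree two in $G$. A graph is Eulerian if all its vertices have even degree (it need not be connected). A subgraph of $G$ is spanning if it contains all vertices of $G$ (possibly some as isolated vertices). For a graph $F$, let $c(F)$ be the number of its components with at least two vertices and $i(F)$ the number of its isolated vertices, and let $\mathrm{exc}(F)=2c(F)+i(F)$. For a subcubic graph $G$, $\mathrm{minexc}(G)$ is the minimum of $\mathrm{exc}(F)$ over all spanning Eulerian subgraphs $F$ of $G$. -}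

module Defs where

open import Data.Bool.Properties using () renaming (_≟_ to _≟ᵇ_)
open import Data.Fin.Base using (Fin; punchIn)
open import Data.Fin.Properties using (_≟_)
open import Data.Fin.Subset using (Subset; ∣_∣)
open import Data.List.Base using (List; []; _∷_; allFin; deduplicate; filter; length; map)
open import Data.List.Membership.Propositional using (_∈_)
open import Data.List.Membership.Propositional.Properties using (∈-allFin)
open import Data.List.Relation.Unary.Any using (here; there)
open import Data.Nat.Base using (ℕ; suc; pred; _+_; _*_; _≤_)
open import Data.Nat.Divisibility using (_∣_)
import Data.Nat.Properties as ℕ
open import Data.Product.Base using (∃-syntax; _×_; _,_)
open import Data.Sum.Base using (_⊎_; inj₁; inj₂)
import Data.Vec.Base as Vec
import Data.Vec.Properties as Vec
open import Level using (0ℓ)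
open import Relation.Binary.Construct.Closure.ReflexiveTransitive using (Star; ε; _◅_; _◅◅_)
open import Relation.Binary.Core using (Rel; _⇒_)
open import Relation.Binary.Definitions using (Decidable; Irreflexive; Symmetric)
open import Relation.Binary.PropositionalEquality using (_≡_; refl)
open import Relation.Nullary.Decidable using (does; map′; _×-dec_; _⊎-dec_)

record Graph (n : ℕ) : Set₁ where
  field
    _~_    : Rel (Fin n) 0ℓ
    _~?_   : Decidable _~_
    ~-sym  : Symmetric _~_
    ~-irr  : Irreflexive _≡_ _~_

open Graph public using () renaming (_~_ to Adj; _~?_ to adj?)

private variable n : ℕ

degree : Graph n → Fin n → ℕ
degree G v = length (filter (adj? G v) (allFin _))

#degree : ℕ → Graph n → ℕ
#degree d G = length (filter (λ v → degree G v ℕ.≟ d) (allFin _))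

n₂ : Graph n → ℕ
n₂ = #degree 2

Subcubic : Graph n → Set
Subcubic G = ∀ v → degree G v ≤ 3

Reachable : Graph n → Rel (Fin n) 0ℓ
Reachable G = Star (Adj G)

Connected : Graph n → Set
Connected G = ∀ u v → Reachable G u v

delete : Graph n → Fin n → Graph (pred n)
delete {suc _} G v = record
  { _~_   = λ x y → Adj G (punchIn v x) (punchIn v y)
  ; _~?_  = λ x y → adj? G (punchIn v x) (punchIn v y)
  ; ~-sym = Graph.~-sym G
  ; ~-irr = λ { refl → Graph.~-irr G refl }
  }

TwoConnected : Graph n → Set
TwoConnected {n} G = 3 ≤ n × Connected G × (∀ v → Connected (delete G v))

-- Reachability is decided as in Warshall's algorithm: `Via G ws u v` says that
-- v can be reached from u through intermediate vertices taken from ws.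

module _ (G : Graph n) where

  Via : List (Fin n) → Rel (Fin n) 0ℓ
  Via []       u v = u ≡ v ⊎ Adj G u v
  Via (w ∷ ws) u v = Via ws u v ⊎ (Via ws u w × Via ws w v)

  via? : ∀ ws → Decidable (Via ws)
  via? []       u v = (u ≟ v) ⊎-dec adj? G u v
  via? (w ∷ ws) u v = via? ws u v ⊎-dec (via? ws u w ×-dec via? ws w v)

  via-base : ∀ ws {u v} → u ≡ v ⊎ Adj G u v → Via ws u v
  via-base []       p = p
  via-base (_ ∷ ws) p = inj₁ (via-base ws p)

  via-trans : ∀ ws {u v w} → w ∈ ws → Via ws u w → Via ws w v → Via ws u v
  via-trans (_ ∷ ws) (here refl) p q = inj₂ (to p , from q)
    where
    to : ∀ {x z} → Via ws x z ⊎ (Via ws x z × Via ws z z) → Via ws x z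
    to (inj₁ p)       = p
    to (inj₂ (p , _)) = p
    from : ∀ {x z} → Via ws z x ⊎ (Via ws z z × Via ws z x) → Via ws z x
    from (inj₁ q)       = q
    from (inj₂ (_ , q)) = q
  via-trans (_ ∷ ws) (there i) (inj₁ p)       (inj₁ q)       = inj₁ (via-trans ws i p q)
  via-trans (_ ∷ ws) (there i) (inj₁ p)       (inj₂ (q , r)) = inj₂ (via-trans ws i p q , r)
  via-trans (_ ∷ ws) (there i) (inj₂ (p , q)) (inj₁ r)       = inj₂ (p , via-trans ws i q r)
  via-trans (_ ∷ ws) (there i) (inj₂ (p , _)) (inj₂ (_ , r)) = inj₂ (p , r)

  via⇒reachable : ∀ ws {u v} → Via ws u v → Reachable G u v
  via⇒reachable []       (inj₁ refl)    = ε
  via⇒reachable []       (inj₂ e)       = e ◅ ε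
  via⇒reachable (_ ∷ ws) (inj₁ p)       = via⇒reachable ws p
  via⇒reachable (_ ∷ ws) (inj₂ (p , q)) = via⇒reachable ws p ◅◅ via⇒reachable ws q

  reachable⇒via : ∀ {u v} → Reachable G u v → Via (allFin n) u v
  reachable⇒via ε       = via-base (allFin n) (inj₁ refl)
  reachable⇒via (e ◅ p) =
    via-trans (allFin n) (∈-allFin _) (via-base (allFin n) (inj₂ e)) (reachable⇒via p)

  reachable? : Decidable (Reachable G)
  reachable? u v = map′ (via⇒reachable (allFin n)) reachable⇒via (via? (allFin n) u v)

component : Graph n → Fin n → Subset n
component G u = Vec.tabulate (λ v → does (reachable? G u v))

components : Graph n → List (Subset n)
components G = deduplicate (Vec.≡-dec _≟ᵇ_) (map (component G) (allFin _))

c : Graph n → ℕ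
c F = length (filter (λ S → 2 ℕ.≤? ∣ S ∣) (components F))

i : Graph n → ℕ
i = #degree 0

exc : Graph n → ℕ
exc F = 2 * c F + i F

Eulerian : Graph n → Set
Eulerian F = ∀ v → 2 ∣ degree F v

-- A spanning subgraph has the same vertex set, so only the edges need comparing.
_SpanningSubgraphOf_ : Graph n → Graph n → Set
F SpanningSubgraphOf G = Adj F ⇒ Adj G

-- `IsMinexc G m` states minexc(G) = m: m is attained and is a lower bound.
IsMinexc : Graph n → ℕ → Set₁
IsMinexc {n} G m =
  (∃[ F ] (F SpanningSubgraphOf G × Eulerian F × exc F ≡ m)) ×
  (∀ (F : Graph n) → F SpanningSubgraphOf G → Eulerian F → m ≤ exc F)

{-# OPTIONS --safe #-}

-- The extremal graph is a ladder with k = (n − 2)/3 columns whose rungs are subdivided and whose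
-- two rows are closed up by a further vertex of degree two at each end.  In the tree obtained by
-- identifying the two rows, a caterpillar, it has k inner vertices and k + 2 leaves, the leaves
-- being exactly the vertices of degree two.  By parity, an Eulerian subgraph uses an edge of one
-- row iff it uses its mirror image, so it is the double of a family of disjoint leaf-to-leaf
-- paths.  Each path becomes a cycle, which contributes 2 and contains two leaves, and each leaf
-- off the paths is isolated and contributes 1; hence the excess is at least k + 2.  The outer
-- cycle, which misses only the k rungs, attains this value.

module Submission where

open import Defs
open import Data.Bool.Base using (Bool; true; false; _xor_; if_then_else_)
open import Data.Bool.Properties using () renaming (_≟_ to _≟ᵇ_)
open import Data.Empty using (⊥; ⊥-elim)
open import Data.Fin.Base using (Fin; zero; suc; toℕ; fromℕ; inject₁; combine; remQuot; punchIn; punchOut)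
open import Data.Fin.Induction using (<-weakInduction)
import Data.Fin.Properties as Fin
open import Data.Fin.Relation.Unary.Top using (view; view-fromℕ; view-inject₁; ‵fromℕ; ‵inject₁)
open import Data.Fin.Subset using (Subset; ∣_∣; ⁅_⁆) renaming (_∈_ to _∈ˢ_)
open import Data.Fin.Subset.Properties
  using (p⊆q⇒∣p∣≤∣q∣; ∣⁅x⁆∣≡1; x∈⁅x⁆; x∈p∧x≢y⇒x∈p-y; x∈p⇒∣p-x∣<∣p∣)
open import Data.Integer.Base as ℤ using (+_)
import Data.Integer.Properties as ℤ
open import Data.Integer.Tactic.RingSolver using (solve-∀)
open import Data.List.Base using (List; []; _∷_; allFin; filter; length; lookup; map)
open import Data.List.Membership.Propositional using (_∈_)
open import Data.List.Membership.Propositional.Properties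
  using (∈-allFin; ∈-filter⁺; ∈-filter⁻; ∈-lookup; ∈-map⁺; ∈-map⁻; ∈-deduplicate⁺; ∈-deduplicate⁻)
import Data.List.Membership.DecPropositional as DecMembership
open import Data.List.Properties using (length-map; length-tabulate)
open import Data.List.Relation.Binary.Subset.Propositional using (_⊆_)
open import Data.List.Relation.Unary.All as All using (All; []; _∷_)
import Data.List.Relation.Unary.All.Properties as All
open import Data.List.Relation.Unary.AllPairs as AllPairs using (AllPairs; []; _∷_)
import Data.List.Relation.Unary.AllPairs.Properties as AllPairs
open import Data.List.Relation.Unary.Any using (here; there; index)
open import Data.List.Relation.Unary.Any.Properties using (lookup-index)
open import Data.List.Relation.Unary.Unique.Propositional using (Unique)
import Data.List.Relation.Unary.Unique.Propositional.Properties as Unique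
open import Data.List.Relation.Unary.Unique.DecPropositional.Properties using (deduplicate-!)
open import Data.Nat.Base using (ℕ; zero; suc; _*_; _≤_; _<_; _%_; z≤n; s≤s) renaming (_+_ to _+ℕ_; _/_ to _/ℕ_)
open import Data.Nat.Divisibility using (_∣_; _∣?_; divides; ∣1⇒≡1)
open import Data.Nat.Tactic.RingSolver using () renaming (solve-∀ to ℕ-solve-∀)
open import Data.Nat.DivMod using (m≡m%n+[m/n]*n)
import Data.Nat.Properties as ℕ
open import Data.Product.Base using (Σ; ∃-syntax; _×_; _,_; proj₁; proj₂)
open import Data.Rational.Base using (_/_; _+_; 1ℚ; toℚᵘ)
open import Data.Rational.Properties using (toℚᵘ-fromℚᵘ; toℚᵘ-injective; toℚᵘ-homo-+)
import Data.Rational.Unnormalised.Base as ℚᵘ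
import Data.Rational.Unnormalised.Properties as ℚᵘ
open import Data.Unit.Base using (⊤; tt)
import Data.Vec.Properties as Vec
open import Function.Base using (_∘_; id)
open import Function.Bundles using (mk⇔)
open import Relation.Binary.Construct.Closure.ReflexiveTransitive as Star using (Star; ε; _◅_; _◅◅_)
open import Relation.Binary.PropositionalEquality
open import Relation.Nullary using (¬_; Dec; yes; no; does; contradiction)
open import Relation.Nullary.Decidable using (map′; _×-dec_; dec-true; does-⇔; from-no)
open import Relation.Unary using (Decidable)

private variable
  A : Set
  n : ℕ

-- Counting in finite lists, and parity of Boolean counts

lookup-injective : {xs : List A} → Unique xs → ∀ i j → lookup xs i ≡ lookup xs j → i ≡ j
lookup-injective (_ ∷ _)   zero    zero    _  = refl
lookup-injective (x∉ ∷ _)  zero    (suc j) eq = contradiction eq (All.lookup x∉ (∈-lookup j))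
lookup-injective (x∉ ∷ _)  (suc i) zero    eq = contradiction (sym eq) (All.lookup x∉ (∈-lookup i))
lookup-injective (_ ∷ xs!) (suc i) (suc j) eq = cong suc (lookup-injective xs! i j eq)

-- Sending a position in `xs` to a position of the same element in `ys` is injective, as `xs` has no
-- repetitions.
unique-⊆⇒length≤ : {xs ys : List A} → Unique xs → xs ⊆ ys → length xs ≤ length ys
unique-⊆⇒length≤ {xs = xs} {ys} xs! xs⊆ys = Fin.injective⇒≤ {f = position} λ {i} {j} eq →
  lookup-injective xs! i j (begin
    lookup xs i              ≡⟨ lookup-index (xs⊆ys (∈-lookup i)) ⟩
    lookup ys (position i)   ≡⟨ cong (lookup ys) eq ⟩
    lookup ys (position j)   ≡⟨ lookup-index (xs⊆ys (∈-lookup j)) ⟨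
    lookup xs j              ∎)
  where
  open ≡-Reasoning
  position : Fin (length xs) → Fin (length ys)
  position i = index (xs⊆ys (∈-lookup i))

length-filter-allFin : {P : Fin n → Set} (P? : Decidable P) {ys : List (Fin n)} → Unique ys →
  (∀ {y} → y ∈ ys → P y) → (∀ {y} → P y → y ∈ ys) → length (filter P? (allFin n)) ≡ length ys
length-filter-allFin {n} P? ys! sound complete = ℕ.≤-antisym
  (unique-⊆⇒length≤ (Unique.filter⁺ P? (Unique.allFin⁺ n)) (complete ∘ proj₂ ∘ ∈-filter⁻ P? {xs = allFin n}))
  (unique-⊆⇒length≤ ys! (∈-filter⁺ P? (∈-allFin _) ∘ sound))

does-true⁻ : (a? : Dec A) → does a? ≡ true → A
does-true⁻ (yes a) _ = a

does-false⁻ : (a? : Dec A) → does a? ≡ false → ¬ A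
does-false⁻ (no ¬a) _ = ¬a

#true : List Bool → ℕ
#true []           = 0
#true (true  ∷ bs) = suc (#true bs)
#true (false ∷ bs) = #true bs

length-filter : {P : A → Set} (P? : Decidable P) (xs : List A) →
                length (filter P? xs) ≡ #true (map (does ∘ P?) xs)
length-filter P? []       = refl
length-filter P? (x ∷ xs) with does (P? x)
... | true  = cong suc (length-filter P? xs)
... | false = length-filter P? xs

even-count₂ : ∀ a b → 2 ∣ #true (a ∷ b ∷ []) → a ≡ b
even-count₂ true  true  _    = refl
even-count₂ false false _    = refl
even-count₂ true  false even = contradiction (∣1⇒≡1 even) λ ()
even-count₂ false true  even = contradiction (∣1⇒≡1 even) λ ()

-- Solved for the middle Boolean, because the neighbours of a row node are listed as previous, next,
-- rung; this yields a recurrence along the row.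
even-count₃ : ∀ a b c → 2 ∣ #true (a ∷ b ∷ c ∷ []) → b ≡ a xor c
even-count₃ true  true  false _    = refl
even-count₃ true  false true  _    = refl
even-count₃ false true  true  _    = refl
even-count₃ false false false _    = refl
even-count₃ true  true  true  even = contradiction even (from-no (2 ∣? 3))
even-count₃ true  false false even = contradiction (∣1⇒≡1 even) λ ()
even-count₃ false true  false even = contradiction (∣1⇒≡1 even) λ ()
even-count₃ false false true  even = contradiction (∣1⇒≡1 even) λ ()

2≤∣p∣ : {p : Subset n} {x y : Fin n} → x ∈ˢ p → y ∈ˢ p → x ≢ y → 2 ≤ ∣ p ∣
2≤∣p∣ x∈p y∈p x≢y = ℕ.≤-trans
  (s≤s (ℕ.≤-trans (s≤s z≤n) (x∈p⇒∣p-x∣<∣p∣ (x∈p∧x≢y⇒x∈p-y y∈p (x≢y ∘ sym)))))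
  (x∈p⇒∣p-x∣<∣p∣ x∈p)

-- Components of arbitrary graphs

module _ (F : Graph n) where

  private
    _≟ˢ_ = Vec.≡-dec {n = n} _≟ᵇ_

    big? : (S : Subset n) → Dec (2 ≤ ∣ S ∣)
    big? S = 2 ℕ.≤? ∣ S ∣

  ∈-component⁺ : ∀ {u v} → Reachable F u v → v ∈ˢ component F u
  ∈-component⁺ {u} {v} r =
    Vec.lookup⇒[]= v _ (trans (Vec.lookup∘tabulate _ v) (dec-true (reachable? F u v) r))

  ∈-component⁻ : ∀ {u v} → v ∈ˢ component F u → Reachable F u v
  ∈-component⁻ {u} {v} v∈ =
    does-true⁻ (reachable? F u v) (trans (sym (Vec.lookup∘tabulate _ v)) (Vec.[]=⇒lookup v∈))

  reachable-sym : ∀ {u v} → Reachable F u v → Reachable F v u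
  reachable-sym = Star.reverse (Graph.~-sym F)

  component-cong : ∀ {u v} → Reachable F u v → component F u ≡ component F v
  component-cong {u} {v} r = Vec.tabulate-cong λ w →
    does-⇔ (mk⇔ (reachable-sym r ◅◅_) (r ◅◅_)) (reachable? F u w) (reachable? F v w)

  component-big : ∀ {u v} → Adj F u v → 2 ≤ ∣ component F u ∣
  component-big e = 2≤∣p∣ (∈-component⁺ ε) (∈-component⁺ (e ◅ ε)) λ eq → Graph.~-irr F eq e

  -- Mutually unreachable vertices have different components, and an incident edge makes each of
  -- these large enough to be counted.
  length≤c : ∀ {us} → AllPairs (λ u v → ¬ Reachable F u v) us → All (λ u → ∃[ v ] Adj F u v) us →
             length us ≤ c F
  length≤c {us} separated active = begin
    length us                     ≡⟨ length-map (component F) us ⟨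
    length (map (component F) us) ≤⟨ unique-⊆⇒length≤ distinct present ⟩
    c F                           ∎
    where
    open ℕ.≤-Reasoning
    distinct : Unique (map (component F) us)
    distinct = AllPairs.map⁺ (AllPairs.map
      (λ ¬r eq → ¬r (∈-component⁻ (subst (_ ∈ˢ_) (sym eq) (∈-component⁺ ε)))) separated)
    present : map (component F) us ⊆ filter big? (components F)
    present S∈ with ∈-map⁻ (component F) S∈
    ... | u , u∈us , refl = ∈-filter⁺ big?
      (∈-deduplicate⁺ _≟ˢ_ (∈-map⁺ (component F) (∈-allFin u)))
      (component-big (proj₂ (All.lookup active u∈us)))

  c≤1 : ∀ r → (∀ {u v} → Adj F u v → Reachable F u r) → c F ≤ 1
  c≤1 r reach = unique-⊆⇒length≤ {ys = component F r ∷ []}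
    (Unique.filter⁺ big? (deduplicate-! _≟ˢ_ (map (component F) (allFin n)))) only
    where
    only : filter big? (components F) ⊆ component F r ∷ []
    only S∈ with ∈-filter⁻ big? {xs = components F} S∈
    ... | S∈cs , big with ∈-map⁻ (component F) (∈-deduplicate⁻ _≟ˢ_ (map (component F) (allFin n)) S∈cs)
    ... | u , _ , refl with Fin.any? (adj? F u)
    ... | yes (_ , e) = here (component-cong (reach e))
    -- Without an incident edge the component of `u` is contained in a singleton, hence not big.
    ... | no isolated = contradiction big (ℕ.<⇒≱ (s≤s (ℕ.≤-trans
            (p⊆q⇒∣p∣≤∣q∣ (singleton ∘ ∈-component⁻)) (ℕ.≤-reflexive (∣⁅x⁆∣≡1 u)))))
      where
      singleton : ∀ {v} → Reachable F u v → v ∈ˢ ⁅ u ⁆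
      singleton ε       = x∈⁅x⁆ u
      singleton (e ◅ _) = contradiction (_ , e) isolated

  length≤i : ∀ {vs} → Unique vs → All (λ v → degree F v ≡ 0) vs → length vs ≤ i F
  length≤i vs! isolated = unique-⊆⇒length≤ vs! λ v∈ →
    ∈-filter⁺ (λ v → degree F v ℕ.≟ 0) (∈-allFin _) (All.lookup isolated v∈)

-- Each step of the walk carries the proofs that its ends differ from `v`, which is what `punchOut`
-- needs to renumber them in `delete G v`.
reachable-delete : ∀ {m} (G : Graph (suc m)) {v x y} →
  Star (λ a b → Adj G a b × v ≢ a × v ≢ b) x y → (v≢x : v ≢ x) (v≢y : v ≢ y) →
  Reachable (delete G v) (punchOut v≢x) (punchOut v≢y)
reachable-delete G {v} ε v≢x v≢y =
  -- Both ends are the same vertex, but come with two proofs of `v ≢ x`; `punchOut` does not depend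
  -- on the proof.
  subst (Reachable (delete G v) _) (Fin.punchOut-cong v refl) ε
reachable-delete G {v} ((e , _ , v≢z) ◅ p) v≢x v≢y =
  subst₂ (Adj G) (sym (Fin.punchIn-punchOut v≢x)) (sym (Fin.punchIn-punchOut v≢z)) e
  ◅ reachable-delete G p v≢z v≢y

-- The rational form of the value

suc≡*4/4+1 : ∀ a → + suc a / 1 ≡ + (a * 4) / 4 + 1ℚ
suc≡*4/4+1 a = toℚᵘ-injective (begin
  toℚᵘ (+ suc a / 1)                      ≈⟨ toℚᵘ-fromℚᵘ (+ suc a ℚᵘ./ 1) ⟩
  -- For unnormalised fractions equality is cross multiplication, so an integer identity suffices.
  + suc a ℚᵘ./ 1                          ≈⟨ ℚᵘ.*≡* cross-multiplied ⟩
  (+ (a * 4) ℚᵘ./ 4) ℚᵘ.+ ℚᵘ.1ℚᵘ          ≈⟨ ℚᵘ.+-congˡ ℚᵘ.1ℚᵘ (toℚᵘ-fromℚᵘ (+ (a * 4) ℚᵘ./ 4)) ⟨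
  toℚᵘ (+ (a * 4) / 4) ℚᵘ.+ toℚᵘ 1ℚ       ≈⟨ toℚᵘ-homo-+ (+ (a * 4) / 4) 1ℚ ⟨
  toℚᵘ (+ (a * 4) / 4 + 1ℚ)               ∎)
  where
  open ℚᵘ.≃-Reasoning
  identity : ∀ x → (+ 1 ℤ.+ x) ℤ.* + 4 ≡ (x ℤ.* + 4 ℤ.* + 1 ℤ.+ + 1 ℤ.* + 4) ℤ.* + 1
  identity = solve-∀
  cross-multiplied : + suc a ℤ.* + 4 ≡ (+ (a * 4) ℤ.* + 1 ℤ.+ + 1 ℤ.* + 4) ℤ.* + 1
  cross-multiplied = subst (λ t → + suc a ℤ.* + 4 ≡ (t ℤ.* + 1 ℤ.+ + 1 ℤ.* + 4) ℤ.* + 1)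
    (sym (ℤ.pos-* a 4)) (identity (+ a))

-- The subdivided ladder

data Row : Set where
  top bot : Row

-- The parameter is `k-1`, so that there is at least one column by construction and the first and
-- last columns exist.
module Ladder (k-1 : ℕ) where

  k N : ℕ
  k = suc k-1
  N = 2 +ℕ k * 3

  -- Here `left` and `right` are the closing vertices and `rung i` is the vertex subdividing the
  -- rung of column `i`. The combinatorics takes place on `V`; `enc` and `dec` transport it to
  -- `Fin N`.
  data V : Set where
    left right : V
    node       : Row → Fin k → V
    rung       : Fin k → V

  enc : V → Fin N
  enc left         = zero
  enc right        = suc zero
  enc (node top i) = suc (suc (combine i zero))
  enc (node bot i) = suc (suc (combine i (suc zero)))
  enc (rung i)     = suc (suc (combine i (suc (suc zero))))

  cell : Fin k × Fin 3 → V
  cell (i , zero)           = node top i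
  cell (i , suc zero)       = node bot i
  cell (i , suc (suc zero)) = rung i

  dec : Fin N → V
  dec zero          = left
  dec (suc zero)    = right
  dec (suc (suc x)) = cell (remQuot {k} 3 x)

  dec-enc : ∀ v → dec (enc v) ≡ v
  dec-enc left         = refl
  dec-enc right        = refl
  dec-enc (node top i) = cong cell (Fin.remQuot-combine i zero)
  dec-enc (node bot i) = cong cell (Fin.remQuot-combine i (suc zero))
  dec-enc (rung i)     = cong cell (Fin.remQuot-combine i (suc (suc zero)))

  enc-dec : ∀ a → enc (dec a) ≡ a
  enc-dec zero          = refl
  enc-dec (suc zero)    = refl
  enc-dec (suc (suc x)) = trans (enc-cell (remQuot {k} 3 x))
    (cong (λ y → suc (suc y)) (Fin.combine-remQuot {k} 3 x))
    where
    enc-cell : ∀ p → enc (cell p) ≡ suc (suc (combine (proj₁ p) (proj₂ p)))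
    enc-cell (i , zero)           = refl
    enc-cell (i , suc zero)       = refl
    enc-cell (i , suc (suc zero)) = refl

  enc-injective : ∀ {x y} → enc x ≡ enc y → x ≡ y
  enc-injective {x} {y} eq = trans (sym (dec-enc x)) (trans (cong dec eq) (dec-enc y))

  _≟ⱽ_ : (x y : V) → Dec (x ≡ y)
  x ≟ⱽ y = map′ enc-injective (cong enc) (enc x Fin.≟ enc y)

  open DecMembership _≟ⱽ_ using (_∈?_)

  length-filter-V : {P : Fin N → Set} (P? : Decidable P) {ys : List V} → Unique ys →
    (∀ {y} → y ∈ ys → P (enc y)) → (∀ {y} → P (enc y) → y ∈ ys) →
    length (filter P? (allFin N)) ≡ length ys
  length-filter-V {P} P? {ys} ys! sound complete = trans
    (length-filter-allFin P? (Unique.map⁺ enc-injective ys!)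
      (λ y∈ → let z , z∈ , eq = ∈-map⁻ enc y∈ in subst P (sym eq) (sound z∈))
      (λ {y} Py → subst (_∈ map enc ys) (enc-dec y)
                    (∈-map⁺ enc (complete (subst P (sym (enc-dec y)) Py)))))
    (length-map enc ys)

  -- A row together with both closing vertices, as a path with positions 0 to k + 1. The two rows
  -- share their ends, and no row node needs a special case for its neighbours.
  spine : Row → Fin (2 +ℕ k) → V
  spine r zero = left
  spine r (suc p) with view p
  ... | ‵fromℕ     = right
  ... | ‵inject₁ i = node r i

  spine-inject₁ : ∀ r i → spine r (suc (inject₁ i)) ≡ node r i
  spine-inject₁ r i rewrite view-inject₁ i = refl

  spine-fromℕ : ∀ r → spine r (suc (fromℕ k)) ≡ right
  spine-fromℕ r rewrite view-fromℕ k = refl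

  -- Along an edge this changes by one on a spine and by zero on a rung, so it separates neighbours
  -- and defines the cuts of the lower bound.
  column : V → ℕ
  column left       = 0
  column right      = suc k
  column (node _ i) = suc (toℕ i)
  column (rung i)   = suc (toℕ i)

  column-spine : ∀ r p → column (spine r p) ≡ toℕ p
  column-spine r zero = refl
  column-spine r (suc p) with view p
  ... | ‵fromℕ     = cong suc (sym (Fin.toℕ-fromℕ k))
  ... | ‵inject₁ i = cong suc (sym (Fin.toℕ-inject₁ i))

  -- The vertex `node r i` has spine position i + 1, so its neighbours have positions i and i + 2.
  prev next : Row → Fin k → V
  prev r i = spine r (inject₁ (inject₁ i))
  next r i = spine r (suc (suc i))

  column-prev : ∀ r i → column (prev r i) ≡ toℕ i
  column-prev r i = trans (column-spine r (inject₁ (inject₁ i)))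
    (trans (Fin.toℕ-inject₁ (inject₁ i)) (Fin.toℕ-inject₁ i))

  column-next : ∀ r i → column (next r i) ≡ 2 +ℕ toℕ i
  column-next r i = column-spine r (suc (suc i))

  prev≢next : ∀ r i → prev r i ≢ next r i
  prev≢next r i eq = ℕ.m≢1+n+m (toℕ i)
    (trans (sym (column-prev r i)) (trans (cong column eq) (column-next r i)))

  last : Fin k
  last = fromℕ k-1

  nbrs : V → List V
  nbrs left       = node top zero ∷ node bot zero ∷ []
  nbrs right      = node top last ∷ node bot last ∷ []
  nbrs (node r i) = prev r i ∷ next r i ∷ rung i ∷ []
  nbrs (rung i)   = node top i ∷ node bot i ∷ []

  ∈-rows : ∀ r {i} → node r i ∈ node top i ∷ node bot i ∷ []
  ∈-rows top = here refl
  ∈-rows bot = there (here refl)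

  prev-sym : ∀ r i → node r i ∈ nbrs (prev r i)
  prev-sym r zero    = ∈-rows r
  prev-sym r (suc i) rewrite spine-inject₁ r (inject₁ i) =
    there (here (sym (spine-inject₁ r (suc i))))

  next-sym : ∀ r i → node r i ∈ nbrs (next r i)
  -- The index `suc i` is replaced by a variable so that its view can be matched.
  next-sym r i = before refl
    where
    before : ∀ {p} → p ≡ suc i → node r i ∈ nbrs (spine r (suc p))
    before {p} eq with view p
    before refl | ‵fromℕ     = ∈-rows r
    before eq   | ‵inject₁ j = here (sym (trans (cong (spine r ∘ inject₁) eq) (spine-inject₁ r i)))

  nbrs-sym : ∀ {x y} → y ∈ nbrs x → x ∈ nbrs y
  nbrs-sym {left}     (here refl)                 = here refl
  nbrs-sym {left}     (there (here refl))         = here refl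
  nbrs-sym {right}    (here refl)                 = there (here (sym (spine-fromℕ top)))
  nbrs-sym {right}    (there (here refl))         = there (here (sym (spine-fromℕ bot)))
  nbrs-sym {node r i} (here refl)                 = prev-sym r i
  nbrs-sym {node r i} (there (here refl))         = next-sym r i
  nbrs-sym {node r i} (there (there (here refl))) = ∈-rows r
  nbrs-sym {rung i}   (here refl)                 = there (there (here refl))
  nbrs-sym {rung i}   (there (here refl))         = there (there (here refl))

  left-nbrs-column : ∀ {y} → y ∈ nbrs left → column y ≡ 1
  left-nbrs-column (here refl)         = refl
  left-nbrs-column (there (here refl)) = refl

  right-nbrs-column : ∀ {y} → y ∈ nbrs right → column y ≡ k
  right-nbrs-column (here refl)         = cong suc (Fin.toℕ-fromℕ k-1)
  right-nbrs-column (there (here refl)) = cong suc (Fin.toℕ-fromℕ k-1)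

  rung-nbrs : ∀ {i y} → y ∈ nbrs (rung i) → ∃[ r ] y ≡ node r i
  rung-nbrs (here eq)         = top , eq
  rung-nbrs (there (here eq)) = bot , eq

  spine≢rung : ∀ r p {i} → spine r p ≢ rung i
  spine≢rung r zero ()
  spine≢rung r (suc p) with view p
  ... | ‵fromℕ     = λ ()
  ... | ‵inject₁ _ = λ ()

  nbrs-irr : ∀ x → ¬ x ∈ nbrs x
  nbrs-irr left       x∈ = contradiction (left-nbrs-column x∈) λ ()
  nbrs-irr right      x∈ = ℕ.1+n≢n (right-nbrs-column x∈)
  nbrs-irr (rung i)   x∈ = contradiction (proj₂ (rung-nbrs x∈)) λ ()
  nbrs-irr (node r i) (here eq) = ℕ.1+n≢n (trans (cong column eq) (column-prev r i))
  nbrs-irr (node r i) (there (here eq)) = ℕ.1+n≢n (sym (trans (cong column eq) (column-next r i)))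
  nbrs-irr (node r i) (there (there (here ())))

  nbrs-unique : ∀ x → Unique (nbrs x)
  nbrs-unique left       = ((λ ()) ∷ []) ∷ [] ∷ []
  nbrs-unique right      = ((λ ()) ∷ []) ∷ [] ∷ []
  nbrs-unique (node r i) = (prev≢next r i ∷ spine≢rung r (inject₁ (inject₁ i)) ∷ [])
                         ∷ (spine≢rung r (suc (suc i)) ∷ []) ∷ [] ∷ []
  nbrs-unique (rung i)   = ((λ ()) ∷ []) ∷ [] ∷ []

  -- The graph and its degrees

  G : Graph N
  G = record
    { _~_   = λ a b → dec b ∈ nbrs (dec a)
    ; _~?_  = λ a b → dec b ∈? nbrs (dec a)
    ; ~-sym = nbrs-sym
    ; ~-irr = λ { {a} refl → nbrs-irr (dec a) }
    }

  G⁺ : ∀ {x y} → y ∈ nbrs x → Adj G (enc x) (enc y)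
  G⁺ {x} {y} = subst₂ (λ x y → y ∈ nbrs x) (sym (dec-enc x)) (sym (dec-enc y))

  G⁻ : ∀ {x y} → Adj G (enc x) (enc y) → y ∈ nbrs x
  G⁻ {x} {y} = subst₂ (λ x y → y ∈ nbrs x) (dec-enc x) (dec-enc y)

  -- All neighbours in `F` occur in `nbrs x`, so the degree is a count of two or three Booleans, to
  -- which the parity lemmas apply.
  degree-subgraph : (F : Graph N) → F SpanningSubgraphOf G → ∀ x →
    degree F (enc x) ≡ #true (map (λ y → does (adj? F (enc x) (enc y))) (nbrs x))
  degree-subgraph F F⊆G x = trans
    (length-filter-V (adj? F (enc x)) (Unique.filter⁺ F? (nbrs-unique x))
      (λ y∈ → proj₂ (∈-filter⁻ F? {xs = nbrs x} y∈)) (λ {y} e → ∈-filter⁺ F? (G⁻ {x} {y} (F⊆G e)) e))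
    (length-filter F? (nbrs x))
    where
    F? : Decidable (λ y → Adj F (enc x) (enc y))
    F? y = adj? F (enc x) (enc y)

  degree-G : ∀ x → degree G (enc x) ≡ length (nbrs x)
  degree-G x = length-filter-V (adj? G (enc x)) (nbrs-unique x) G⁺ G⁻

  subcubic : Subcubic G
  subcubic a = subst (λ a → degree G a ≤ 3) (enc-dec a)
    (subst (_≤ 3) (sym (degree-G (dec a))) (bound (dec a)))
    where
    bound : ∀ x → length (nbrs x) ≤ 3
    bound left       = s≤s (s≤s z≤n)
    bound right      = s≤s (s≤s z≤n)
    bound (node r i) = ℕ.≤-refl
    bound (rung i)   = s≤s (s≤s z≤n)

  rungs : List V
  rungs = map rung (allFin k)

  ∈-rungs : ∀ i → rung i ∈ rungs
  ∈-rungs i = ∈-map⁺ rung (∈-allFin i)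

  rungs-unique : Unique rungs
  rungs-unique = Unique.map⁺ (λ { refl → refl }) (Unique.allFin⁺ k)

  length-rungs : length rungs ≡ k
  length-rungs = trans (length-map rung (allFin k)) (length-tabulate {n = k} id)

  -- Row nodes have three neighbours; the two closing vertices and the k rung vertices have two.
  n₂-G : n₂ G ≡ 2 +ℕ k
  n₂-G = trans (length-filter-V (λ a → degree G a ℕ.≟ 2)
      ((( λ ()) ∷ All.map⁺ (All.universal (λ _ ()) (allFin k)))
        ∷ All.map⁺ (All.universal (λ _ ()) (allFin k)) ∷ rungs-unique)
      (λ {x} x∈ → trans (degree-G x) (sound x∈))
      (λ {x} eq → complete x (trans (sym (degree-G x)) eq)))
    (cong (2 +ℕ_) length-rungs)
    where
    sound : ∀ {x} → x ∈ left ∷ right ∷ rungs → length (nbrs x) ≡ 2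
    sound (here refl)         = refl
    sound (there (here refl)) = refl
    sound (there (there x∈)) with ∈-map⁻ rung x∈
    ... | _ , _ , refl = refl
    complete : ∀ x → length (nbrs x) ≡ 2 → x ∈ left ∷ right ∷ rungs
    complete left     _ = here refl
    complete right    _ = there (here refl)
    complete (rung i) _ = there (there (∈-rungs i))

  -- Walks inside a vertex set, and 2-connectedness

  Within : (V → Set) → V → V → Set
  Within Ok x y = y ∈ nbrs x × Ok x × Ok y

  module _ {Ok : V → Set} where

    within-sym : ∀ {x y} → Within Ok x y → Within Ok y x
    within-sym (e , x-ok , y-ok) = nbrs-sym e , y-ok , x-ok

    row-connected : ∀ r → (∀ i → Ok (node r i)) → ∀ i → Star (Within Ok) (node r i) (node r zero)
    row-connected r ok = <-weakInduction _ ε λ i →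
      (here (sym (spine-inject₁ r (inject₁ i))) , ok (suc i) , ok (inject₁ i)) ◅_

    -- Walks follow the rows and change rows at `left`. This serves the deletion of a rung vertex
    -- and the connectedness of the outer cycle.
    rows-and-left-connected : (∀ r i → Ok (node r i)) → Ok left →
      ∀ x → Ok x → Star (Within Ok) x (node top zero)
    rows-and-left-connected row-ok left-ok left x-ok = (here refl , x-ok , row-ok top zero) ◅ ε
    rows-and-left-connected row-ok left-ok right x-ok =
      (here refl , x-ok , row-ok top last) ◅ row-connected top (row-ok top) last
    rows-and-left-connected row-ok left-ok (node top i) x-ok = row-connected top (row-ok top) i
    rows-and-left-connected row-ok left-ok (node bot i) x-ok = row-connected bot (row-ok bot) i
      ◅◅ (here refl , row-ok bot zero , left-ok) ◅ (here refl , left-ok , row-ok top zero) ◅ ε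
    rows-and-left-connected row-ok left-ok (rung i) x-ok =
      (here refl , x-ok , row-ok top i) ◅ row-connected top (row-ok top) i

    -- Each node of the other row comes over by its own rung, then follows row `r`. This serves the
    -- deletion of a closing vertex or of a node of the other row.
    row-and-rungs-connected : ∀ r → (∀ i → Ok (node r i)) → (∀ i → Ok (rung i)) →
      ∀ x → Ok x → Star (Within Ok) x (node r zero)
    row-and-rungs-connected r row-ok rung-ok left x-ok = (∈-rows r , x-ok , row-ok zero) ◅ ε
    row-and-rungs-connected r row-ok rung-ok right x-ok =
      (∈-rows r , x-ok , row-ok last) ◅ row-connected r row-ok last
    row-and-rungs-connected r row-ok rung-ok (rung i) x-ok =
      (∈-rows r , x-ok , row-ok i) ◅ row-connected r row-ok i
    row-and-rungs-connected r row-ok rung-ok (node _ i) x-ok =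
      (there (there (here refl)) , x-ok , rung-ok i) ◅ (∈-rows r , rung-ok i , row-ok i)
      ◅ row-connected r row-ok i

  -- Deleting one vertex leaves intact either a row with all rungs, or both rows with `left`; the
  -- target `z` is the first node of an intact row.
  connected-avoiding : ∀ v → ∃[ z ] (∀ x → v ≢ x → Star (Within (v ≢_)) x z)
  connected-avoiding left         = _ , row-and-rungs-connected top (λ _ ()) (λ _ ())
  connected-avoiding right        = _ , row-and-rungs-connected top (λ _ ()) (λ _ ())
  connected-avoiding (node top _) = _ , row-and-rungs-connected bot (λ _ ()) (λ _ ())
  connected-avoiding (node bot _) = _ , row-and-rungs-connected top (λ _ ()) (λ _ ())
  connected-avoiding (rung _)     = _ , rows-and-left-connected (λ _ _ ()) (λ ())

  connected : Connected G
  connected a b = subst₂ (Reachable G) (enc-dec a) (enc-dec b)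
    (Star.gmap enc (λ {x} {y} → G⁺ {x} {y} ∘ proj₁) (to (dec a) ◅◅ Star.reverse within-sym (to (dec b))))
    where
    to : ∀ x → Star (Within (λ _ → ⊤)) x (node top zero)
    to x = row-and-rungs-connected top (λ _ → tt) (λ _ → tt) x tt

  connected-delete : ∀ v → Connected (delete G v)
  connected-delete v a b = subst₂ (Reachable (delete G v)) (Fin.punchOut-punchIn v) (Fin.punchOut-punchIn v)
    (reachable-delete G (subst₂ (Star _) (enc-dec _) (enc-dec _)
        (Star.gmap enc lift (to (punchIn v a) (v≢ a) ◅◅ Star.reverse within-sym (to (punchIn v b) (v≢ b)))))
      (v≢ a) (v≢ b))
    where
    v≢ : ∀ a → v ≢ punchIn v a
    v≢ a = Fin.punchInᵢ≢i v a ∘ sym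
    lift : ∀ {x y} → Within (dec v ≢_) x y → Adj G (enc x) (enc y) × v ≢ enc x × v ≢ enc y
    lift {x} {y} (e , v≢x , v≢y) = G⁺ {x} {y} e
      , (λ eq → v≢x (trans (cong dec eq) (dec-enc x))) , (λ eq → v≢y (trans (cong dec eq) (dec-enc y)))
    to : ∀ a → v ≢ a → Star (Within (dec v ≢_)) (dec a) (proj₁ (connected-avoiding (dec v)))
    to a v≢a = proj₂ (connected-avoiding (dec v)) (dec a)
      λ eq → v≢a (trans (sym (enc-dec v)) (trans (cong enc eq) (enc-dec a)))

  twoConnected : TwoConnected G
  twoConnected = s≤s (s≤s (s≤s z≤n)) , connected , connected-delete

  -- The outer cycle, which attains the bound

  OnCycle : V → Set
  OnCycle (rung _) = ⊥
  OnCycle _        = ⊤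

  onCycle? : Decidable OnCycle
  onCycle? left       = yes tt
  onCycle? right      = yes tt
  onCycle? (node _ _) = yes tt
  onCycle? (rung _)   = no λ ()

  spine-onCycle : ∀ r p → OnCycle (spine r p)
  spine-onCycle r zero = tt
  spine-onCycle r (suc p) with view p
  ... | ‵fromℕ     = tt
  ... | ‵inject₁ _ = tt

  -- As the rungs are subdivided, no edge joins the two rows directly; so the subgraph induced off
  -- the rung vertices is exactly the outer cycle.
  C : Graph N
  C = record
    { _~_   = λ a b → Within OnCycle (dec a) (dec b)
    ; _~?_  = λ a b → (dec b ∈? nbrs (dec a)) ×-dec onCycle? (dec a) ×-dec onCycle? (dec b)
    ; ~-sym = within-sym {OnCycle}
    ; ~-irr = λ { {a} refl (e , _) → nbrs-irr (dec a) e }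
    }

  C⁺ : ∀ {x y} → Within OnCycle x y → Adj C (enc x) (enc y)
  C⁺ {x} {y} = subst₂ (Within OnCycle) (sym (dec-enc x)) (sym (dec-enc y))

  C⁻ : ∀ {x y} → Adj C (enc x) (enc y) → Within OnCycle x y
  C⁻ {x} {y} = subst₂ (Within OnCycle) (dec-enc x) (dec-enc y)

  degree-C-onCycle : ∀ x → OnCycle x → degree C (enc x) ≡ 2
  degree-C-onCycle left _ = length-filter-V (adj? C (enc left)) (nbrs-unique left)
    (λ { (here refl) → C⁺ {left} {node top zero} (here refl , tt , tt)
       ; (there (here refl)) → C⁺ {left} {node bot zero} (there (here refl) , tt , tt) })
    (λ {y} e → proj₁ (C⁻ {left} {y} e))
  degree-C-onCycle right _ = length-filter-V (adj? C (enc right)) (nbrs-unique right)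
    (λ { (here refl) → C⁺ {right} {node top last} (here refl , tt , tt)
       ; (there (here refl)) → C⁺ {right} {node bot last} (there (here refl) , tt , tt) })
    (λ {y} e → proj₁ (C⁻ {right} {y} e))
  degree-C-onCycle (node r i) _ = length-filter-V (adj? C (enc (node r i))) {prev r i ∷ next r i ∷ []}
    ((prev≢next r i ∷ []) ∷ [] ∷ [])
    (λ { (here refl) → C⁺ {node r i} {prev r i}
           (here refl , tt , spine-onCycle r (inject₁ (inject₁ i)))
       ; (there (here refl)) → C⁺ {node r i} {next r i}
           (there (here refl) , tt , spine-onCycle r (suc (suc i))) })
    (λ {y} e → spine-only (C⁻ {node r i} {y} e))
    where
    spine-only : ∀ {y} → Within OnCycle (node r i) y → y ∈ prev r i ∷ next r i ∷ []
    spine-only (here eq , _)         = here eq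
    spine-only (there (here eq) , _) = there (here eq)
    spine-only (there (there (here refl)) , _ , ())

  degree-C-rung : ∀ i → degree C (enc (rung i)) ≡ 0
  degree-C-rung i = length-filter-V (adj? C (enc (rung i))) {[]} []
    (λ ()) (λ {y} e → ⊥-elim (proj₁ (proj₂ (C⁻ {rung i} {y} e))))

  C-eulerian : Eulerian C
  C-eulerian a = subst (λ a → 2 ∣ degree C a) (enc-dec a) (even (dec a))
    where
    even : ∀ x → 2 ∣ degree C (enc x)
    even x with onCycle? x
    ... | yes on = divides 1 (degree-C-onCycle x on)
    even (rung i) | no _ = divides 0 (degree-C-rung i)
    even left | no ¬on = contradiction tt ¬on
    even right | no ¬on = contradiction tt ¬on
    even (node _ _) | no ¬on = contradiction tt ¬on

  i-C : i C ≡ k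
  i-C = trans (length-filter-V (λ a → degree C a ℕ.≟ 0) rungs-unique sound (λ {x} → complete x))
              length-rungs
    where
    sound : ∀ {x} → x ∈ rungs → degree C (enc x) ≡ 0
    sound x∈ with ∈-map⁻ rung x∈
    ... | j , _ , refl = degree-C-rung j
    2≢0 : ∀ {d} → d ≡ 2 → d ≢ 0
    2≢0 refl ()
    complete : ∀ x → degree C (enc x) ≡ 0 → x ∈ rungs
    complete left       eq = contradiction eq (2≢0 (degree-C-onCycle left tt))
    complete right      eq = contradiction eq (2≢0 (degree-C-onCycle right tt))
    complete (node r j) eq = contradiction eq (2≢0 (degree-C-onCycle (node r j) tt))
    complete (rung j)   _  = ∈-rungs j

  -- All edges lie in the component of the first top node, which costs 2, and each of the k rung
  -- vertices costs 1.
  exc-C≤ : exc C ≤ 2 +ℕ k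
  exc-C≤ = ℕ.+-mono-≤ (ℕ.*-monoʳ-≤ 2 (c≤1 C (enc (node top zero)) λ {a} (_ , on , _) → reach a on))
                      (ℕ.≤-reflexive i-C)
    where
    reach : ∀ a → OnCycle (dec a) → Reachable C a (enc (node top zero))
    reach a on = subst (λ a → Reachable C a (enc (node top zero))) (enc-dec a)
      (Star.gmap enc (λ {x} {y} → C⁺ {x} {y})
        (rows-and-left-connected (λ _ _ → tt) tt (dec a) on))

  -- Lower bound by a sweep over the cuts between consecutive columns

  crossing : ∀ {x y} (p : Fin (suc k)) → y ∈ nbrs x → column x ≤ toℕ p → toℕ p < column y →
             ∃[ r ] x ≡ spine r (inject₁ p) × y ≡ spine r (suc p)
  crossing {left} zero (here refl)         _ _ = top , refl , refl
  crossing {left} zero (there (here refl)) _ _ = bot , refl , refl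
  crossing {left} (suc p) y∈ _ p<y =
    contradiction (subst (suc (toℕ p) <_) (left-nbrs-column y∈) p<y) λ { (s≤s ()) }
  crossing {right} p _ x≤p _ =
    contradiction (ℕ.≤-trans x≤p (ℕ.≤-pred (Fin.toℕ<n p))) ℕ.1+n≰n
  crossing {rung i} p y∈ x≤p p<y with rung-nbrs y∈
  ... | _ , refl = contradiction x≤p (ℕ.<⇒≱ p<y)
  crossing {node r i} p (here refl) x≤p p<y =
    contradiction x≤p (ℕ.<⇒≱ (ℕ.<-trans p<y (s≤s (ℕ.≤-reflexive (column-prev r i)))))
  crossing {node r i} p (there (there (here refl))) x≤p p<y = contradiction x≤p (ℕ.<⇒≱ p<y)
  -- Of the edges at a row node only the one to `next` increases the column; the bounds then force
  -- `p` to be `suc i`.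
  crossing {node r i} p (there (here refl)) x≤p p<y
    with Fin.toℕ-injective {i = suc i} {p}
           (ℕ.≤-antisym x≤p (ℕ.≤-pred (subst (toℕ p <_) (column-next r i) p<y)))
  ... | refl = r , sym (spine-inject₁ r i) , refl

  module EulerianSubgraph (F : Graph N) (F⊆G : F SpanningSubgraphOf G) (F-eulerian : Eulerian F) where

    has : V → V → Bool
    has x y = does (adj? F (enc x) (enc y))

    has-sym : ∀ x y → has x y ≡ has y x
    has-sym x y = does-⇔ (mk⇔ (Graph.~-sym F) (Graph.~-sym F)) (adj? F _ _) (adj? F _ _)

    even-nbrs : ∀ x → 2 ∣ #true (map (has x) (nbrs x))
    even-nbrs x = subst (2 ∣_) (degree-subgraph F F⊆G x) (F-eulerian (enc x))

    spineEdge : Row → Fin (suc k) → Bool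
    spineEdge r p = has (spine r (inject₁ p)) (spine r (suc p))

    rungEdge : Row → Fin k → Bool
    rungEdge r j = has (rung j) (node r j)

    -- Parity at the subdividing vertex: both halves of a rung are used, or neither.
    rungEdges-agree : ∀ j → rungEdge top j ≡ rungEdge bot j
    rungEdges-agree j = even-count₂ _ _ (even-nbrs (rung j))

    -- Parity at `node r j`.
    spineEdge-suc : ∀ r j → spineEdge r (suc j) ≡ spineEdge r (inject₁ j) xor rungEdge r j
    spineEdge-suc r j = begin
      has (spine r (suc (inject₁ j))) (next r j)
        ≡⟨ cong (λ x → has x (next r j)) (spine-inject₁ r j) ⟩
      has (node r j) (next r j)
        ≡⟨ even-count₃ (has (node r j) (prev r j)) _ _ (even-nbrs (node r j)) ⟩
      has (node r j) (prev r j) xor has (node r j) (rung j)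
        ≡⟨ cong₂ _xor_ (has-sym (node r j) (prev r j)) (has-sym (node r j) (rung j)) ⟩
      has (prev r j) (node r j) xor rungEdge r j
        ≡⟨ cong (λ x → has (prev r j) x xor rungEdge r j) (spine-inject₁ r j) ⟨
      spineEdge r (inject₁ j) xor rungEdge r j ∎
      where open ≡-Reasoning

    -- The mirror symmetry: parity at `left` makes the rows agree at the start, and both then obey
    -- the same recurrence with equal rung terms.
    spineEdges-agree : ∀ p → spineEdge top p ≡ spineEdge bot p
    spineEdges-agree = <-weakInduction _ (even-count₂ _ _ (even-nbrs left)) λ j eq →
      trans (spineEdge-suc top j) (trans (cong₂ _xor_ eq (rungEdges-agree j)) (sym (spineEdge-suc bot j)))

    -- Testing the top row is enough, since the mirror edge is then absent too.
    Cut : Fin (suc k) → Set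
    Cut p = spineEdge top p ≡ false

    -- A step back over the cut would use one of its two spine edges, and `F` contains neither.
    cut-closed : ∀ {p a b} → Cut p → Reachable F a b → toℕ p < column (dec a) → toℕ p < column (dec b)
    cut-closed cut ε p<a = p<a
    cut-closed {p} {a} cut (_◅_ {j = b} e path) p<a with toℕ p ℕ.<? column (dec b)
    ... | yes p<b = cut-closed cut path p<b
    -- `crossing` treats edges directed to the right, so the offending edge is reversed.
    ... | no p≮b with crossing p (nbrs-sym (F⊆G e)) (ℕ.≮⇒≥ p≮b) p<a
    ... | r , b≡ , a≡ = contradiction
            (subst₂ (Adj F) (trans (sym (enc-dec b)) (cong enc b≡)) (trans (sym (enc-dec a)) (cong enc a≡))
              (Graph.~-sym F e))
            (does-false⁻ (adj? F _ _) (cut-at r))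
      where
      cut-at : ∀ r → spineEdge r p ≡ false
      cut-at top = cut
      cut-at bot = trans (sym (spineEdges-agree p)) cut

    -- The neighbour list enters through an equation, so that one lemma covers both closing vertices
    -- and all rung vertices.
    leaf-isolated : ∀ x {y z} → nbrs x ≡ y ∷ z ∷ [] → has x y ≡ false → has x z ≡ false →
                    degree F (enc x) ≡ 0
    leaf-isolated x eq y∉ z∉ = trans (degree-subgraph F F⊆G x) (lemma eq y∉ z∉)
      where
      lemma : ∀ {y z xs} → xs ≡ y ∷ z ∷ [] → has x y ≡ false → has x z ≡ false → #true (map (has x) xs) ≡ 0
      lemma refl y∉ z∉ rewrite y∉ | z∉ = refl

    -- Evidence gathered left of column `p` that `F` has excess at least `weight`: `actives`
    -- represent different nontrivial components, costing 2 each, and `isolateds` cost 1 each. The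
    -- column bounds keep later additions new.
    record Certificate (p weight : ℕ) : Set where
      field
        actives isolateds : List V
        separated  : AllPairs (λ x y → ¬ Reachable F (enc x) (enc y)) actives
        active     : All (λ x → ∃[ b ] Adj F (enc x) b) actives
        active<p   : All (λ x → column x < p) actives
        distinct   : Unique isolateds
        isolated   : All (λ x → degree F (enc x) ≡ 0) isolateds
        isolated<p : All (λ x → column x < p) isolateds
        weight≡    : weight ≡ 2 * length actives +ℕ length isolateds

    open Certificate

    empty : Certificate 0 0
    empty = record
      { actives = [] ; isolateds = [] ; separated = [] ; active = [] ; active<p = []
      ; distinct = [] ; isolated = [] ; isolated<p = [] ; weight≡ = refl }

    widen : ∀ {p q w} → p ≤ q → Certificate p w → Certificate q w
    widen p≤q cert = record
      { actives    = actives cert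
      ; isolateds  = isolateds cert
      ; separated  = separated cert
      ; active     = active cert
      ; active<p   = All.map (λ x<p → ℕ.<-≤-trans x<p p≤q) (active<p cert)
      ; distinct   = distinct cert
      ; isolated   = isolated cert
      ; isolated<p = All.map (λ x<p → ℕ.<-≤-trans x<p p≤q) (isolated<p cert)
      ; weight≡    = weight≡ cert
      }

    addIsolated : ∀ {p w} x → p ≤ column x → degree F (enc x) ≡ 0 → Certificate p w →
                  Certificate (suc (column x)) (suc w)
    addIsolated {p} x p≤x x-isolated cert = record
      { actives    = actives wide
      ; isolateds  = x ∷ isolateds wide
      ; separated  = separated wide
      ; active     = active wide
      ; active<p   = active<p wide
      ; distinct   = All.map (λ { y<p refl → ℕ.<⇒≱ y<p p≤x }) (isolated<p cert) ∷ distinct wide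
      ; isolated   = x-isolated ∷ isolated wide
      ; isolated<p = ℕ.≤-refl ∷ isolated<p wide
      ; weight≡    = trans (cong suc (weight≡ cert)) (sym (ℕ.+-suc _ _))
      }
      where wide = widen (ℕ.m≤n⇒m≤1+n p≤x) cert

    -- A component is paid for in full when its first leaf is met; `apart` distinguishes it from the
    -- earlier ones.
    addActive : ∀ {p w} x → p ≤ column x → (∃[ b ] Adj F (enc x) b) →
                (∀ {y} → column y < p → ¬ Reachable F (enc x) (enc y)) → Certificate p w →
                Certificate (suc (column x)) (2 +ℕ w)
    addActive {p} x p≤x x-active apart cert = record
      { actives    = x ∷ actives wide
      ; isolateds  = isolateds wide
      ; separated  = All.map apart (active<p cert) ∷ separated wide
      ; active     = x-active ∷ active wide
      ; active<p   = ℕ.≤-refl ∷ active<p wide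
      ; distinct   = distinct wide
      ; isolated   = isolated wide
      ; isolated<p = isolated<p wide
      ; weight≡    = trans (cong (2 +ℕ_) (weight≡ cert))
                       (cong (_+ℕ length (isolateds cert)) (sym (ℕ.*-suc 2 (length (actives cert)))))
      }
      where wide = widen (ℕ.m≤n⇒m≤1+n p≤x) cert

    -- The p + 1 leaves left of the cut count 1 each; a cycle crossing the cut has been paid for
    -- in full (2) although only one of its two leaves has been met.
    cutWeight : ℕ → Bool → ℕ
    cutWeight p crossed = if crossed then 2 +ℕ p else suc p

    certificate-left : ∀ b → spineEdge top zero ≡ b → Certificate 1 (cutWeight 0 b)
    certificate-left true eq =
      -- No column is smaller than 0, so separation is vacuous.
      addActive left z≤n (_ , does-true⁻ (adj? F _ _) eq) (λ ()) empty
    certificate-left false eq =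
      addIsolated left z≤n (leaf-isolated left refl eq (trans (sym (spineEdges-agree zero)) eq)) empty

    certificate-step : ∀ j b t → spineEdge top (inject₁ j) ≡ b → rungEdge top j ≡ t →
      Certificate (suc (toℕ j)) (cutWeight (toℕ j) b) →
      Certificate (2 +ℕ toℕ j) (cutWeight (suc (toℕ j)) (b xor t))
    -- The cycle ends at its second, prepaid leaf: the weight stays j + 2.
    certificate-step j true  true  _   _  = widen (ℕ.n≤1+n _)
    certificate-step j true  false _   ¬t =
      addIsolated (rung j) ℕ.≤-refl (leaf-isolated (rung j) refl ¬t (trans (sym (rungEdges-agree j)) ¬t))
    certificate-step j false false _   ¬t =
      addIsolated (rung j) ℕ.≤-refl (leaf-isolated (rung j) refl ¬t (trans (sym (rungEdges-agree j)) ¬t))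
    -- A new cycle starts. The cut before it is empty, so by `cut-closed` it cannot reach any
    -- earlier representative.
    certificate-step j false true  cut t  =
      addActive (rung j) ℕ.≤-refl (_ , does-true⁻ (adj? F _ _) t) λ {y} y<p path →
        ℕ.<⇒≱ y<p (subst₂ _<_ (Fin.toℕ-inject₁ j) (cong column (dec-enc y))
          (cut-closed {inject₁ j} cut path
            (subst₂ _<_ (sym (Fin.toℕ-inject₁ j)) (cong column (sym (dec-enc (rung j)))) ℕ.≤-refl)))

    certificate : ∀ p → Certificate (suc (toℕ p)) (cutWeight (toℕ p) (spineEdge top p))
    certificate = <-weakInduction _ (certificate-left _ refl) λ j cert →
      subst (λ b → Certificate _ (cutWeight _ b)) (sym (spineEdge-suc top j))
        (certificate-step j _ _ refl refl
          (subst (λ p → Certificate (suc p) (cutWeight p (spineEdge top (inject₁ j)))) (Fin.toℕ-inject₁ j) cert))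

    -- The last leaf either ends the cycle crossing the last cut, already paid for, or is isolated
    -- and adds 1.
    certificate-right : ∀ b → spineEdge top (fromℕ k) ≡ b →
      Certificate (suc k) (cutWeight k b) → Certificate (2 +ℕ k) (2 +ℕ k)
    certificate-right true  _  = widen (ℕ.n≤1+n _)
    certificate-right false eq = addIsolated right ℕ.≤-refl
      (leaf-isolated right refl (at-right top eq) (at-right bot (trans (sym (spineEdges-agree (fromℕ k))) eq)))
      where
      at-right : ∀ r → spineEdge r (fromℕ k) ≡ false → has right (node r last) ≡ false
      at-right r eq = trans (has-sym right (node r last))
        (subst₂ (λ x y → has x y ≡ false) (spine-inject₁ r last) (spine-fromℕ r) eq)

    2+k≤exc : 2 +ℕ k ≤ exc F
    2+k≤exc = begin
      2 +ℕ k                                               ≡⟨ weight≡ cert ⟩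
      2 * length (actives cert) +ℕ length (isolateds cert) ≤⟨ ℕ.+-mono-≤ (ℕ.*-monoʳ-≤ 2 actives≤c) isolateds≤i ⟩
      exc F                                                ∎
      where
      open ℕ.≤-Reasoning
      cert = certificate-right _ refl
        (subst (λ p → Certificate (suc p) (cutWeight p (spineEdge top (fromℕ k)))) (Fin.toℕ-fromℕ k)
          (certificate (fromℕ k)))
      actives≤c : length (actives cert) ≤ c F
      actives≤c = subst (_≤ c F) (length-map enc (actives cert))
        (length≤c F (AllPairs.map⁺ (separated cert)) (All.map⁺ (active cert)))
      isolateds≤i : length (isolateds cert) ≤ i F
      isolateds≤i = subst (_≤ i F) (length-map enc (isolateds cert))
        (length≤i F (Unique.map⁺ enc-injective (distinct cert)) (All.map⁺ (isolated cert)))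

  -- The value of minexc and the choice of k

  minexc-G : IsMinexc G (2 +ℕ k)
  -- The lower bound applied to `C` itself supplies the other half of the equality.
  minexc-G = (C , proj₁ , C-eulerian , ℕ.≤-antisym exc-C≤ (EulerianSubgraph.2+k≤exc C proj₁ C-eulerian))
           , EulerianSubgraph.2+k≤exc

  -- The sum of `N` and `n₂ G` is (2 + 3k) + (2 + k) = 4(k + 1).
  fraction : + (2 +ℕ k) / 1 ≡ + (N +ℕ n₂ G) / 4 + 1ℚ
  fraction = subst (λ m → + (2 +ℕ k) / 1 ≡ + m / 4 + 1ℚ)
    (sym (trans (cong (N +ℕ_) n₂-G) (total k))) (suc≡*4/4+1 (suc k))
    where
    total : ∀ k → (2 +ℕ k * 3) +ℕ (2 +ℕ k) ≡ suc k * 4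
    total = ℕ-solve-∀

proposition29 : ∀ (n : ℕ) → 5 ≤ n → n % 3 ≡ 2 →
    Σ (Graph n) λ G →
    TwoConnected G × Subcubic G ×
    (∃[ m ] (IsMinexc G m × (+ m) / 1 ≡ (+ (n +ℕ n₂ G)) / 4 + 1ℚ))
proposition29 n 5≤n n%3≡2 = build n (n /ℕ 3)
    (trans (m≡m%n+[m/n]*n n 3) (cong (_+ℕ n /ℕ 3 * 3) n%3≡2)) 5≤n
  where
  -- With `n` a variable the equation can be matched; k = 0 would give n = 2, against `5 ≤ n`.
  build : ∀ n k → n ≡ 2 +ℕ k * 3 → 5 ≤ n →
    Σ (Graph n) λ G →
    TwoConnected G × Subcubic G ×
    (∃[ m ] (IsMinexc G m × (+ m) / 1 ≡ (+ (n +ℕ n₂ G)) / 4 + 1ℚ))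
  build _ zero      refl (s≤s (s≤s ()))
  build _ (suc k-1) refl _ = G , twoConnected , subcubic , 2 +ℕ suc k-1 , minexc-G , fraction
    where open Ladder k-1
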